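{- Let $\Delta G$ be a set of edge weight increases on $G$, and let $G'=G\oplus\Delta G$ be the updated graph. Run Algorithm 2 (Label Search, Increase) on the stable tree labelling $L$ of $G$ over a stable tree hierarchy $T$ and on $\Delta G$. Denote by $L_\Delta^+$ the set of vertex pairs $(v,r)$ for which a pair $(d,v)$ enters the queue $Q_r$ in Algorithm 2. Then, for a vertex $v$ and $r\in\mathrm{Anc}(v)$, $(v,r)\in L_\Delta^+$ if and only if $P_{G'}^r(v,r)$ differs from $P_G^r(v,r)$.
   Context: A road network is a finite undirected graph $G=(V,E,\phi)$ with edge weights $\phi(u,v)\in\mathbb{R}_{\ge 0}$. A path is a sequence of vertices $(v_1,\dots,v_k)$ with $(v_i,v_{i+1})\in E$; its weight is $\sum_{i=1}^{k-1}\phi(v_i,v_{i+1})$. Shortest paths are paths of minimal weight and the distance is that weight ($\infty$ if no path exists). $N_G(v)=\{(u,\phi(u,v)): (u,v)\in E\}$. Two sets of shortest paths are regarded as different if they differ as sets of paths or if the length (weight) of the paths differs. A stable tree hierarchy over $G$ is a rooted binary tree $T=(\mathcal{N},\mathcal{E},\ell)$, where $\mathcal{N}$ is a set of tree nodes, $\mathcal{E}$ a set of tree edges, and $\ell:V(G)\to\mathcal{N}$ a total surjective function, such that: (1) for a constant $0<\beta\le 0.5$, each $N\in\mathcal{N}$ with left and right children $N_l,N_r$ satisfies $|T_\downarrow(N_l)|,|T_\downarrow(N_r)|\le(1-\beta)\,|T_\downarrow(N)|$, where $T_\downarrow(N)$ is the subtree rooted at $N$ (its size being the number of vertices of $G$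 mapped by $\ell$ into it); (2) for any two vertices $s,t$, every path between $s$ and $t$ in $G$ contains a vertex of $\mathrm{Ca}(s,t)$, the set of vertices mapped by $\ell$ to common ancestors of $\ell(s)$ and $\ell(t)$ in $T$ (a node counts as an ancestor of itself). Fix an arbitrary total order $\preceq_t$ on $V$. Then $w\preceq v$ iff $\ell(w)$ is a strict ancestor of $\ell(v)$, or $\ell(w)=\ell(v)$ and $w\preceq_t v$. Put $\mathrm{Anc}(v)=\{w: w\preceq v\}$, $\mathrm{Desc}(w)=\{x: w\preceq x\}$; the label index is $\tau(v)=|\{w: w\preceq v,\ w\ne v\}|$. For $v,u\in\mathrm{Desc}(w)$, $d_G^w(v,u)$ and $P_G^w(v,u)$ are the distance and the set of shortest paths between $v$ and $u$ in the induced subgraph $G[\mathrm{Desc}(w)]$. The stable tree labelling $L$ of $G$ over $T$ stores for each vertex $v$ and each $r\in\mathrm{Anc}(v)$ the value $L_v[r]=d_G^r(v,r)$. $\Delta G$ is a set of triples $(a,b,\phi_{old})$, at most one per edge, each meaning that the weight of the edge $(a,b)\in E$, which is $\phi_{old}$ in $G$, is increased to a larger value; triples are oriented so that $\tau(b)>\tau(a)$. $G'=G\oplus\Delta G$ is the graph obtained by applying all these updates. Algorithm 2 (Label Search, Increase). There is an initially empty priority queue $Q_r$ for each vertex $r$. Equality tests are considered false when the values are infinite. Step 1: for each $(a,b,\phi_{old})\in\Delta G$ and each $r\in\mathrm{Anc}(a)$: if $L_a[r]+\phi_{old}=L_b[r]$, add $(L_a[r]+\phi_{old},b)$ to $Q_r$;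 else if $L_b[r]+\phi_{old}=L_a[r]$, add $(L_b[r]+\phi_{old},a)$ to $Q_r$. Step 2: for each $Q_r$, start with $V_{\mathrm{AFF}}=\emptyset$ and repeatedly extract a pair $(d,v)$ with smallest $d$ until $Q_r$ is empty; if $v\notin V_{\mathrm{AFF}}$, add $v$ to $V_{\mathrm{AFF}}$ and, for each $(n,\phi_n)\in N_G(v)$ with $\tau(n)>\tau(r)$ and $d+\phi_n=L_n[r]$, add $(d+\phi_n,n)$ to $Q_r$. Then call Repair$(r,V_{\mathrm{AFF}})$. Repair$(r,V_{\mathrm{AFF}})$: for each $v\in V_{\mathrm{AFF}}$, set $L_v[r]\leftarrow\infty$, then $L_v[r]\leftarrow\min\{L_n[r]+\phi : (n,\phi)\in N_{G'}(v),\ n\notin V_{\mathrm{AFF}},\ \tau(n)>\tau(r)\}$, and if $L_v[r]\ne\infty$ add $(L_v[r],v)$ to $Q_r$. Then repeatedly extract $(d,v)$ with smallest $d$ from $Q_r$ until it is empty; if $d<L_v[r]$, set $L_v[r]\leftarrow d$ and, for each $(n,\phi_n)\in N_{G'}(v)$ with $\tau(n)>\tau(r)$ and $d+\phi_n<L_n[r]$, add $(d+\phi_n,n)$ to $Q_r$.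
   Formalization: The old weight of every increased edge is assumed positive; for an increased edge (a,b) of old weight 0 the claim fails at (a,a), since the path (a,b,a) ceases to be shortest but a never enters the queue Q_a. -}

module Defs where

open import Algebra.Bundles using (CommutativeRing)
import Algebra.Definitions.RawMonoid as RawMonoidDefs
open import Data.Bool.Base using (true; false; if_then_else_)
open import Data.Bool.Properties using (∨-comm)
open import Data.Fin.Base using (Fin)
open import Data.Fin.Properties using (_≟_)
open import Data.List.Base as List
  using (List; []; _∷_; _++_; map; filter; concatMap; allFin)
import Data.List.Extrema as Extrema
open import Data.List.Membership.Propositional using (_∈_; _∉_)
import Data.List.Membership.DecPropositional as DecMembership
open import Data.List.Relation.Binary.Permutation.Propositional using (_↭_)
open import Data.List.Relation.Unary.All as All using (All; []; _∷_)
open import Data.List.Relation.Unary.AllPairs using (AllPairs)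
open import Data.List.Relation.Unary.Any using (Any)
open import Data.Nat.Base as ℕ using (ℕ)
import Data.Nat.Properties as ℕₚ
open import Data.Product.Base using (∃; _×_; _,_; proj₁; proj₂)
open import Data.Sum.Base using (_⊎_; inj₁; inj₂)
import Data.Vec.Base as Vec
open import Function.Bundles using (_⇔_)
open import Function.Definitions using (StrictlySurjective)
open import Level using (Level; 0ℓ; _⊔_) renaming (suc to lsuc)
open import Relation.Binary.Bundles using (DecTotalOrder; TotalOrder)
open import Relation.Binary.Core using (Rel)
open import Relation.Binary.Definitions using (Decidable)
open import Relation.Binary.PropositionalEquality
  using (_≡_; _≢_; refl; cong)
open import Relation.Binary.Structures using (IsDecTotalOrder)
import Relation.Binary.Construct.Add.Supremum.Equality as SupEquality
import Relation.Binary.Construct.Add.Supremum.NonStrict as SupNonStrict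
import Relation.Binary.Construct.Add.Supremum.Strict as SupStrict
import Relation.Binary.Construct.NonStrictToStrict as ToStrict
open import Relation.Nullary using (¬_; Dec; yes; no; does; ¬?; _×-dec_; _⊎-dec_)
open import Relation.Nullary.Decidable using (map′)
open import Relation.Nullary.Construct.Add.Supremum using (_⁺; [_]; ⊤⁺)
open import Relation.Unary using (Pred)

------------------------------------------------------------------------
-- Weights

-- Stands in for ℝ, which the library does not provide: classically ℝ is an
-- instance, and completeness is not required.
record OrderedField (c ℓ₁ ℓ₂ : Level) : Set (lsuc (c ⊔ ℓ₁ ⊔ ℓ₂)) where
  infix 4 _≤_
  field
    commutativeRing : CommutativeRing c ℓ₁

  open CommutativeRing commutativeRing public

  field
    _≤_             : Rel Carrier ℓ₂
    isDecTotalOrder : IsDecTotalOrder _≈_ _≤_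
    0≉1             : ¬ (0# ≈ 1#)
    inverse         : ∀ x → ¬ (x ≈ 0#) → ∃ λ y → x * y ≈ 1#
    +-monoʳ-≤       : ∀ z {x y} → x ≤ y → z + x ≤ z + y
    *-nonneg        : ∀ {x y} → 0# ≤ x → 0# ≤ y → 0# ≤ x * y

  decTotalOrder : DecTotalOrder c ℓ₁ ℓ₂
  decTotalOrder = record { isDecTotalOrder = isDecTotalOrder }

  open IsDecTotalOrder isDecTotalOrder public
    using (_≤?_; total; antisym; ≤-respˡ-≈; ≤-respʳ-≈)
    renaming (_≟_ to _≈?_; refl to ≤-refl; trans to ≤-trans; reflexive to ≤-reflexive)

  open ToStrict _≈_ _≤_ public using (_<_)

  _<?_ : Decidable _<_
  _<?_ = ToStrict.<-decidable _≈_ _≤_ _≈?_ _≤?_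

  fromℕ : ℕ → Carrier
  fromℕ k = RawMonoidDefs._×_ +-rawMonoid k 1#

  -- Carrier ⁺ adjoins ∞, written ⊤⁺.
  open SupEquality _≈_ public using (_≈⁺_; ≈⁺-dec)
  open SupStrict _<_ public using (_<⁺_; <⁺-dec)

  _≈⁺?_ : Decidable _≈⁺_
  _≈⁺?_ = ≈⁺-dec _≈?_

  _<⁺?_ : Decidable _<⁺_
  _<⁺?_ = <⁺-dec _<?_

  totalOrder⁺ : TotalOrder c (c ⊔ ℓ₁) (c ⊔ ℓ₂)
  totalOrder⁺ = record
    { isTotalOrder = SupNonStrict.≤⁺-isTotalOrder _≤_
                       (IsDecTotalOrder.isTotalOrder isDecTotalOrder) }

  infixl 6 _+⁺_
  _+⁺_ : Carrier ⁺ → Carrier → Carrier ⁺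
  [ x ] +⁺ y = [ x + y ]
  ⊤⁺    +⁺ y = ⊤⁺

  minimum⁺ : List (Carrier ⁺) → Carrier ⁺
  minimum⁺ = Extrema.min totalOrder⁺ ⊤⁺

------------------------------------------------------------------------
-- Road networks, paths and distances

-- The values of φ at non-edges are junk and never matter.
record RoadNetwork {c ℓ₁ ℓ₂} (K : OrderedField c ℓ₁ ℓ₂) (n : ℕ)
                   : Set (lsuc 0ℓ ⊔ c ⊔ ℓ₁ ⊔ ℓ₂) where
  open OrderedField K using (Carrier; _≈_; _≤_; _+_; 0#)
  field
    Edge     : Rel (Fin n) 0ℓ
    edge?    : Decidable Edge
    edge-sym : ∀ {u v} → Edge u v → Edge v u
    φ        : Fin n → Fin n → Carrier
    φ-sym    : ∀ {u v} → Edge u v → φ u v ≈ φ v u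
    φ-nonneg : ∀ {u v} → Edge u v → 0# ≤ φ u v

  -- Vertices may repeat.
  data IsPath : Fin n → Fin n → List (Fin n) → Set where
    [_] : ∀ v → IsPath v v (v ∷ [])
    _∷_ : ∀ {v w u p} → Edge v w → IsPath w u p → IsPath v u (v ∷ p)

  weight : List (Fin n) → Carrier
  weight []          = 0#
  weight (v ∷ [])    = 0#
  weight (v ∷ w ∷ p) = φ v w + weight (w ∷ p)

  -- Paths in the subgraph induced by D.
  IsPathIn : Pred (Fin n) 0ℓ → Fin n → Fin n → List (Fin n) → Set
  IsPathIn D v u p = IsPath v u p × All D p

  IsShortestPath : Pred (Fin n) 0ℓ → Fin n → Fin n → List (Fin n) → Set ℓ₂
  IsShortestPath D v u p =
    IsPathIn D v u p × (∀ q → IsPathIn D v u q → weight p ≤ weight q)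

  IsDistance : Pred (Fin n) 0ℓ → Fin n → Fin n → Carrier ⁺ → Set (ℓ₁ ⊔ ℓ₂)
  IsDistance D v u [ x ] = ∃ λ p → IsShortestPath D v u p × weight p ≈ x
  IsDistance D v u ⊤⁺    = Level.Lift (ℓ₁ ⊔ ℓ₂) (∀ p → ¬ IsPathIn D v u p)

module _ {c ℓ₁ ℓ₂} {K : OrderedField c ℓ₁ ℓ₂} {n : ℕ} where

  open RoadNetwork using (IsShortestPath; IsDistance)

  record SameShortestPaths (G G′ : RoadNetwork K n) (D : Pred (Fin n) 0ℓ)
                           (v u : Fin n) : Set (c ⊔ ℓ₁ ⊔ ℓ₂) where
    field
      same-paths  : ∀ p → IsShortestPath G D v u p ⇔ IsShortestPath G′ D v u p
      same-length : ∀ x → IsDistance G D v u x ⇔ IsDistance G′ D v u x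

  DifferentShortestPaths : (G G′ : RoadNetwork K n) (D : Pred (Fin n) 0ℓ)
                           (v u : Fin n) → Set (c ⊔ ℓ₁ ⊔ ℓ₂)
  DifferentShortestPaths G G′ D v u = ¬ SameShortestPaths G G′ D v u

------------------------------------------------------------------------
-- Rooted binary trees

data Tree : Set where
  ∅    : Tree
  node : Tree → Tree → Tree

data Node : Tree → Set where
  root  : ∀ {l r} → Node (node l r)
  left  : ∀ {l r} → Node l → Node (node l r)
  right : ∀ {l r} → Node r → Node (node l r)

infix 4 _⊑_
data _⊑_ : ∀ {t} → Node t → Node t → Set where
  root  : ∀ {l r} {N : Node (node l r)} → root ⊑ N
  left  : ∀ {l r} {M N : Node l} → M ⊑ N → left {l} {r} M ⊑ left N
  right : ∀ {l r} {M N : Node r} → M ⊑ N → right {l} {r} M ⊑ right N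

data _IsChildOf_ : ∀ {t} → Node t → Node t → Set where
  root-left  : ∀ {l r t} → left {node l r} {t} root IsChildOf root
  root-right : ∀ {l r t} → right {t} {node l r} root IsChildOf root
  left       : ∀ {l r} {M N : Node l} → M IsChildOf N → left {l} {r} M IsChildOf left N
  right      : ∀ {l r} {M N : Node r} → M IsChildOf N → right {l} {r} M IsChildOf right N

infix 4 _≟ᴺ_ _⊑?_
_≟ᴺ_ : ∀ {t} → Decidable {A = Node t} _≡_
root    ≟ᴺ root    = yes refl
root    ≟ᴺ left N  = no λ ()
root    ≟ᴺ right N = no λ ()
left M  ≟ᴺ root    = no λ ()
left M  ≟ᴺ left N  = map′ (cong left) (λ { refl → refl }) (M ≟ᴺ N)
left M  ≟ᴺ right N = no λ ()
right M ≟ᴺ root    = no λ ()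
right M ≟ᴺ left N  = no λ ()
right M ≟ᴺ right N = map′ (cong right) (λ { refl → refl }) (M ≟ᴺ N)

_⊑?_ : ∀ {t} → Decidable {A = Node t} _⊑_
root    ⊑? N       = yes root
left M  ⊑? root    = no λ ()
left M  ⊑? left N  = map′ left (λ { (left p) → p }) (M ⊑? N)
left M  ⊑? right N = no λ ()
right M ⊑? root    = no λ ()
right M ⊑? left N  = no λ ()
right M ⊑? right N = map′ right (λ { (right p) → p }) (M ⊑? N)

------------------------------------------------------------------------
-- Stable tree hierarchies

record StableTreeHierarchy {c ℓ₁ ℓ₂} {K : OrderedField c ℓ₁ ℓ₂} {n : ℕ}
                           (G : RoadNetwork K n) : Set (c ⊔ ℓ₁ ⊔ ℓ₂) where
  open OrderedField K
    using (Carrier; _≈_; _≤_; _<_; _+_; _*_; _-_; 0#; 1#; fromℕ)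
  open RoadNetwork G using (IsPath)
  field
    tree         : Tree
    ℓ            : Fin n → Node tree
    ℓ-surjective : StrictlySurjective _≡_ ℓ

  -- The number of vertices mapped into the subtree rooted at N.
  size : Node tree → ℕ
  size N = Vec.count (λ v → N ⊑? ℓ v) (Vec.allFin n)

  Ca : Fin n → Fin n → Pred (Fin n) 0ℓ
  Ca s t x = ℓ x ⊑ ℓ s × ℓ x ⊑ ℓ t

  -- A missing child is an empty subtree and satisfies the balance condition
  -- trivially, so only the children that are present are constrained.
  field
    β         : Carrier
    0<β       : 0# < β
    β≤½       : β + β ≤ 1#
    balanced  : ∀ {M N} → M IsChildOf N → fromℕ (size M) ≤ (1# - β) * fromℕ (size N)
    separates : ∀ {s t p} → IsPath s t p → Any (Ca s t) p

module VertexOrder {c ℓ₁ ℓ₂} {K : OrderedField c ℓ₁ ℓ₂} {n : ℕ} {G : RoadNetwork K n}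
                   (T : StableTreeHierarchy G)
                   {_≤ₜ_ : Rel (Fin n) 0ℓ} (O : IsDecTotalOrder _≡_ _≤ₜ_) where
  open StableTreeHierarchy T using (ℓ)
  open IsDecTotalOrder O using () renaming (_≤?_ to _≤ₜ?_)

  infix 4 _⪯_ _⪯?_
  _⪯_ : Rel (Fin n) 0ℓ
  w ⪯ v = (ℓ w ⊑ ℓ v × ℓ w ≢ ℓ v) ⊎ (ℓ w ≡ ℓ v × w ≤ₜ v)

  _⪯?_ : Decidable _⪯_
  w ⪯? v = (ℓ w ⊑? ℓ v ×-dec ¬? (ℓ w ≟ᴺ ℓ v)) ⊎-dec (ℓ w ≟ᴺ ℓ v ×-dec w ≤ₜ? v)

  -- r ∈ Anc(v) is written r ⪯ v throughout.
  Desc : Fin n → Pred (Fin n) 0ℓ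
  Desc w x = w ⪯ x

  τ : Fin n → ℕ
  τ v = Vec.count (λ w → (w ⪯? v) ×-dec ¬? (w ≟ v)) (Vec.allFin n)

------------------------------------------------------------------------
-- Weight increases

module _ {c ℓ₁ ℓ₂} {K : OrderedField c ℓ₁ ℓ₂} {n : ℕ} where
  open OrderedField K
    using (Carrier; _≈_; _≤_; _<_; 0#; ≤-trans; ≤-respʳ-≈) renaming (sym to ≈-sym; refl to ≈-refl)

  -- The triple (a , b , φ-old) together with the weight it is increased to.
  record Update : Set c where
    field
      a b         : Fin n
      φ-old φ-new : Carrier

  open Update

  Updates : Update → Fin n → Fin n → Set
  Updates δ u v = (a δ ≡ u × b δ ≡ v) ⊎ (a δ ≡ v × b δ ≡ u)

  updates? : ∀ δ u v → Dec (Updates δ u v)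
  updates? δ u v = (a δ ≟ u ×-dec b δ ≟ v) ⊎-dec (a δ ≟ v ×-dec b δ ≟ u)

  record IsIncrease (G : RoadNetwork K n) (δ : Update) : Set (ℓ₁ ⊔ ℓ₂) where
    open RoadNetwork G using (Edge; φ)
    field
      edge     : Edge (a δ) (b δ)
      old      : φ-old δ ≈ φ (a δ) (b δ)
      increase : φ-old δ < φ-new δ

  record WeightIncreases (G : RoadNetwork K n) : Set (c ⊔ ℓ₁ ⊔ ℓ₂) where
    field
      updates      : List Update
      areIncreases : All (IsIncrease G) updates
      one-per-edge : AllPairs (λ δ ε → ¬ Updates δ (a ε) (b ε)) updates

  updatedWeight : (Fin n → Fin n → Carrier) → List Update → Fin n → Fin n → Carrier
  updatedWeight φ []       u v = φ u v
  updatedWeight φ (δ ∷ Δ) u v =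
    if does (updates? δ u v) then φ-new δ else updatedWeight φ Δ u v

  infixl 6 _⊕_
  _⊕_ : (G : RoadNetwork K n) → WeightIncreases G → RoadNetwork K n
  G ⊕ ΔG = record
    { Edge     = Edge
    ; edge?    = edge?
    ; edge-sym = edge-sym
    ; φ        = updatedWeight φ updates
    ; φ-sym    = φ′-sym updates
    ; φ-nonneg = φ′-nonneg areIncreases
    }
    where
    open RoadNetwork G
    open WeightIncreases ΔG

    φ′-sym : ∀ Δ {u v} → Edge u v → updatedWeight φ Δ u v ≈ updatedWeight φ Δ v u
    φ′-sym []      e = φ-sym e
    φ′-sym (δ ∷ Δ) {u} {v} e
      rewrite ∨-comm (does (a δ ≟ u ×-dec b δ ≟ v)) (does (a δ ≟ v ×-dec b δ ≟ u))
      with does (updates? δ v u)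
    ... | true  = ≈-refl
    ... | false = φ′-sym Δ e

    φ′-nonneg : ∀ {Δ} → All (IsIncrease G) Δ → ∀ {u v} → Edge u v →
                0# ≤ updatedWeight φ Δ u v
    φ′-nonneg []                    e = φ-nonneg e
    φ′-nonneg {δ ∷ Δ} (inc ∷ incs) {u} {v} e with does (updates? δ u v)
    ... | true  = ≤-trans (≤-respʳ-≈ (≈-sym old) (φ-nonneg edge)) (proj₁ increase)
      where open IsIncrease inc
    ... | false = φ′-nonneg incs e

------------------------------------------------------------------------
-- Label Search (Increase)

module LabelSearch {c ℓ₁ ℓ₂} {K : OrderedField c ℓ₁ ℓ₂} {n : ℕ} {G : RoadNetwork K n}
                   (T : StableTreeHierarchy G)
                   {_≤ₜ_ : Rel (Fin n) 0ℓ} (O : IsDecTotalOrder _≡_ _≤ₜ_)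
                   (ΔG : WeightIncreases G) where
  open OrderedField K using
    (Carrier; _≤_; _+_; _≈?_; _≈⁺_; _≈⁺?_; _<⁺_; _<⁺?_; _+⁺_; minimum⁺)
  open RoadNetwork G using (IsDistance; edge?; φ)
  open RoadNetwork (G ⊕ ΔG) using () renaming (edge? to edge′?; φ to φ′)
  open WeightIncreases ΔG using (updates)
  open VertexOrder T O
  open DecMembership (_≟_ {n}) using (_∈?_)
  open Update

  -- L v r is L_v[r]; the entries with r ∉ Anc(v) are junk.
  Labels : Set c
  Labels = Fin n → Fin n → Carrier ⁺

  IsStableTreeLabelling : Labels → Set (ℓ₁ ⊔ ℓ₂)
  IsStableTreeLabelling L = ∀ v r → r ⪯ v → IsDistance (Desc r) v r (L v r)

  infixl 5 _[_,_]≔_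
  _[_,_]≔_ : Labels → Fin n → Fin n → Carrier ⁺ → Labels
  (L [ v , r ]≔ x) w s = if does (w ≟ v ×-dec s ≟ r) then x else L w s

  -- A queue is a bag of pairs (d , v), represented by a list up to permutation.
  -- All keys are finite.
  Queue : Set c
  Queue = List (Carrier × Fin n)

  -- Ties between equal keys may be broken either way.
  ExtractMin : Queue → Carrier × Fin n → Queue → Set (c ⊔ ℓ₂)
  ExtractMin Q e Q′ = Q ↭ e ∷ Q′ × All (λ f → proj₁ e ≤ proj₁ f) Q′

  -- Step 1. If either label is infinite, both equality tests are false.
  seed : Labels → Fin n → Update {K = K} {n} → Queue
  seed L r δ with L (a δ) r | L (b δ) r
  ... | [ x ] | [ y ] =
    if does (x + φ-old δ ≈? y) then (x + φ-old δ , b δ) ∷ []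
    else if does (y + φ-old δ ≈? x) then (y + φ-old δ , a δ) ∷ []
    else []
  ... | _     | _     = []

  seeds : Labels → Fin n → Queue
  seeds L r = concatMap (seed L r) (filter (λ δ → r ⪯? a δ) updates)

  -- Step 2. The test [ x ] ≈⁺ y is false for y = ∞.
  affectedNeighbours : Labels → Fin n → Carrier → Fin n → Queue
  affectedNeighbours L r d v =
    map (λ w → d + φ v w , w)
        (filter (λ w → edge? v w ×-dec (τ r ℕₚ.<? τ w) ×-dec ([ d + φ v w ] ≈⁺? L w r))
                (allFin n))

  -- Search L r Q A A′ E: the loop started with queue Q and V_AFF = A can end with
  -- V_AFF = A′, the pairs in E having been added to the queue on the way.
  data Search (L : Labels) (r : Fin n) :
              Queue → List (Fin n) → List (Fin n) → Queue → Set (c ⊔ ℓ₂) where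
    done  : ∀ {A} → Search L r [] A A []
    skip  : ∀ {Q Q′ d v A A′ E} → ExtractMin Q (d , v) Q′ → v ∈ A →
            Search L r Q′ A A′ E → Search L r Q A A′ E
    visit : ∀ {Q Q′ d v A A′ E} → ExtractMin Q (d , v) Q′ → v ∉ A →
            Search L r (affectedNeighbours L r d v ++ Q′) (v ∷ A) A′ E →
            Search L r Q A A′ (affectedNeighbours L r d v ++ E)

  boundary : Labels → Fin n → List (Fin n) → Fin n → Carrier ⁺
  boundary L r A v =
    minimum⁺ (map (λ w → L w r +⁺ φ′ v w)
                  (filter (λ w → edge′? v w ×-dec ¬? (w ∈? A) ×-dec (τ r ℕₚ.<? τ w))
                          (allFin n)))

  entry : Carrier ⁺ → Fin n → Queue
  entry [ d ] v = (d , v) ∷ []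
  entry ⊤⁺    v = []

  -- The first loop of Repair, over the list of vertices still to be handled.
  reset : Fin n → List (Fin n) → List (Fin n) → Labels → Labels × Queue
  reset r A []       L = L , []
  reset r A (v ∷ vs) L =
    let L₁     = L [ v , r ]≔ ⊤⁺
        x      = boundary L₁ r A v
        L₂ , Q = reset r A vs (L₁ [ v , r ]≔ x)
    in L₂ , entry x v ++ Q

  improvedNeighbours : Labels → Fin n → Carrier → Fin n → Queue
  improvedNeighbours L r d v =
    map (λ w → d + φ′ v w , w)
        (filter (λ w → edge′? v w ×-dec (τ r ℕₚ.<? τ w) ×-dec ([ d + φ′ v w ] <⁺? L w r))
                (allFin n))

  -- The second loop of Repair; the indices are as for Search, with labels for V_AFF.
  data Relax (r : Fin n) : Labels → Queue → Labels → Queue → Set (c ⊔ ℓ₁ ⊔ ℓ₂) where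
    done    : ∀ {L} → Relax r L [] L []
    stale   : ∀ {L L′ Q Q′ d v E} → ExtractMin Q (d , v) Q′ → ¬ [ d ] <⁺ L v r →
              Relax r L Q′ L′ E → Relax r L Q L′ E
    improve : ∀ {L L′ Q Q′ d v E} → ExtractMin Q (d , v) Q′ → [ d ] <⁺ L v r →
              let L₁ = L [ v , r ]≔ [ d ]
                  N  = improvedNeighbours L₁ r d v
              in Relax r L₁ (N ++ Q′) L′ E → Relax r L Q L′ (N ++ E)

  -- Everything that happens to Q_r once Step 1 has filled it with Q.  The final
  -- index lists all pairs that ever enter Q_r, including those of Step 1.
  data Round (r : Fin n) (L : Labels) (Q : Queue) : Labels → Queue → Set (c ⊔ ℓ₁ ⊔ ℓ₂) where
    round : ∀ {A vs L′ E E′} → Search L r Q [] A E → vs ↭ A →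
            let L₁ , Q₁ = reset r A vs L
            in Relax r L₁ Q₁ L′ E′ → Round r L Q L′ (Q ++ E ++ Q₁ ++ E′)

  -- Step 1 is completed for every queue before Step 2 begins, so all queues are
  -- seeded from the initial labels L₀.
  data Rounds (L₀ : Labels) : List (Fin n) → Labels → Labels → List (Fin n × Fin n) →
              Set (c ⊔ ℓ₁ ⊔ ℓ₂) where
    []  : ∀ {L} → Rounds L₀ [] L L []
    _∷_ : ∀ {r rs L L₁ L′ E S} → Round r L (seeds L₀ r) L₁ E → Rounds L₀ rs L₁ L′ S →
          Rounds L₀ (r ∷ rs) L L′ (map (λ e → proj₂ e , r) E ++ S)

  -- Run L L′ S: a complete execution turns the labels L into L′, and S lists the
  -- pairs (v , r) such that some (d , v) enters Q_r.
  data Run (L L′ : Labels) (S : List (Fin n × Fin n)) : Set (c ⊔ ℓ₁ ⊔ ℓ₂) where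
    run : ∀ {rs} → rs ↭ allFin n → Rounds L rs L L′ S → Run L L′ S

{-# OPTIONS --safe #-}
module Submission where

-- A vertex v enters Q_r exactly when ΔG lengthens some shortest path p from v to r in
-- G[Desc r], that is, weight p < weight′ p.  Each entry (d , v) of the search comes with
-- such a path of weight d.  Conversely, such a path has a last updated edge; the tail of
-- that edge is seeded (a positive old weight prevents both seeding tests from holding),
-- and from there each vertex of the path is queued when its successor is visited.
-- Repair enqueues only vertices of V_AFF: its keys are at least the weight in G of some
-- path, so they cannot improve the unchanged labels outside V_AFF.  Finally, a lengthened
-- shortest path changes the distance or ceases to be shortest, and if none is lengthened
-- then the shortest paths and their weights are the same in both graphs.

open import Algebra.Properties.Group using (∙-cancelˡ; \\-leftDividesʳ)
open import Data.Bool.Base using (true; false)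
open import Data.Empty using (⊥-elim)
open import Data.Fin.Base using (Fin)
open import Data.Fin.Properties using (_≟_)
open import Data.List.Base using (List; []; _∷_; _++_; map; filter; allFin)
import Data.List.Extrema as Extrema
import Data.List.Membership.DecPropositional as DecMembership
open import Data.List.Membership.Propositional using (_∈_; _∉_; find; lose)
open import Data.List.Membership.Propositional.Properties
  using (∈-allFin; ∈-map⁺; ∈-map⁻; ∈-++⁺ˡ; ∈-++⁺ʳ; ∈-++⁻; ∈-concatMap⁺; ∈-filter⁺;
         ∈-filter⁻)
open import Data.List.Relation.Binary.Permutation.Propositional using (↭-sym; ↭⇒↭ₛ)
open import Data.List.Relation.Binary.Permutation.Propositional.Properties
  using (All-resp-↭; ∈-resp-↭)
import Data.List.Relation.Binary.Permutation.Setoid.Properties as PermSetoid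
open import Data.List.Relation.Binary.Subset.Propositional using (_⊆_)
open import Data.List.Relation.Unary.All as All using (All; []; _∷_)
import Data.List.Relation.Unary.All.Properties as Allₚ
open import Data.List.Relation.Unary.AllPairs using ([]; _∷_)
open import Data.List.Relation.Unary.Any using (Any; here; there)
open import Data.List.Relation.Unary.Unique.Propositional using (Unique)
import Data.List.Relation.Unary.Unique.Propositional.Properties as Uniqueₚ
open import Data.Nat.Base as ℕ using (ℕ)
import Data.Nat.Properties as ℕₚ
open import Data.Product.Base using (∃; _×_; _,_; proj₁; proj₂)
import Data.Product.Properties as Productₚ
open import Data.Sum.Base using (_⊎_; inj₁; inj₂; [_,_]′)
open import Data.Vec.Base as Vec using (Vec; count)
import Data.Vec.Membership.Propositional.Properties as VecMembership
import Data.Vec.Relation.Unary.Any as VecAny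
open import Function.Base using (_∘_; id)
open import Function.Bundles using (_⇔_; mk⇔; Equivalence)
open import Level using (0ℓ; lift)
open import Relation.Binary.Core using (Rel)
open import Relation.Binary.Bundles using (DecTotalOrder)
import Relation.Binary.Construct.Add.Supremum.Equality as SupEquality
import Relation.Binary.Construct.Add.Supremum.Strict as SupStrict
import Relation.Binary.Construct.NonStrictToStrict as ToStrict
open import Relation.Binary.PropositionalEquality as ≡
  using (_≡_; _≢_; refl; cong; subst; setoid)
import Relation.Binary.Reasoning.PartialOrder as ≤-Reasoning
open import Relation.Binary.Structures using (IsDecTotalOrder)
open import Relation.Nullary
  using (¬_; Dec; yes; no; does; proof; ofʸ; ofⁿ; ¬?; _×-dec_; contradiction)
open import Relation.Nullary.Construct.Add.Supremum using ([_]; ⊤⁺)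
open import Relation.Nullary.Decidable using (dec-false)
open import Relation.Unary using (Pred; Decidable) renaming (_⊆_ to _⊆ᴾ_)
open import Defs

-- Strict monotonicity of counting.

module _ {a p q} {A : Set a} {P : Pred A p} {Q : Pred A q}
         (P? : Decidable P) (Q? : Decidable Q) (P⊆Q : P ⊆ᴾ Q) where

  count-mono-≤ : ∀ {m} (xs : Vec A m) → count P? xs ℕ.≤ count Q? xs
  count-mono-≤ Vec.[] = ℕ.z≤n
  count-mono-≤ (x Vec.∷ xs) with P? x | Q? x
  ... | yes _  | yes _  = ℕ.s≤s (count-mono-≤ xs)
  ... | yes px | no ¬qx = contradiction (P⊆Q px) ¬qx
  ... | no _   | yes _  = ℕₚ.m≤n⇒m≤1+n (count-mono-≤ xs)
  ... | no _   | no _   = count-mono-≤ xs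

  count-mono-< : ∀ {m} {xs : Vec A m} → VecAny.Any (λ x → Q x × ¬ P x) xs →
                 count P? xs ℕ.< count Q? xs
  count-mono-< {xs = x Vec.∷ xs} any with P? x | Q? x
  count-mono-< {xs = _ Vec.∷ _} (VecAny.here (_ , ¬px)) | yes px | _ =
    contradiction px ¬px
  count-mono-< {xs = _ Vec.∷ _} (VecAny.here (qx , _)) | no _ | no ¬qx =
    contradiction qx ¬qx
  count-mono-< {xs = _ Vec.∷ xs} (VecAny.here _) | no _ | yes _ = ℕ.s≤s (count-mono-≤ xs)
  count-mono-< {xs = _ Vec.∷ _} (VecAny.there any) | yes _ | yes _ = ℕ.s≤s (count-mono-< any)
  count-mono-< {xs = _ Vec.∷ _} (VecAny.there any) | yes px | no ¬qx =
    contradiction (P⊆Q px) ¬qx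
  count-mono-< {xs = _ Vec.∷ _} (VecAny.there any) | no _ | yes _ =
    ℕₚ.m≤n⇒m≤1+n (count-mono-< any)
  count-mono-< {xs = _ Vec.∷ _} (VecAny.there any) | no _ | no _ = count-mono-< any

-- The ancestor order on tree nodes.

⊑-reflexive : ∀ {t} {M N : Node t} → M ≡ N → M ⊑ N
⊑-reflexive {M = root}    refl = root
⊑-reflexive {M = left M}  refl = left (⊑-reflexive refl)
⊑-reflexive {M = right M} refl = right (⊑-reflexive refl)

⊑-trans : ∀ {t} {M N P : Node t} → M ⊑ N → N ⊑ P → M ⊑ P
⊑-trans root      _         = root
⊑-trans (left p)  (left q)  = left (⊑-trans p q)
⊑-trans (right p) (right q) = right (⊑-trans p q)

⊑-antisym : ∀ {t} {M N : Node t} → M ⊑ N → N ⊑ M → M ≡ N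
⊑-antisym root      root      = refl
⊑-antisym (left p)  (left q)  = cong left (⊑-antisym p q)
⊑-antisym (right p) (right q) = cong right (⊑-antisym p q)

-- Ancestors of one node all lie on the path to it from the root.
⊑-chain : ∀ {t} {M N P : Node t} → M ⊑ P → N ⊑ P → M ⊑ N ⊎ N ⊑ M
⊑-chain root      _    = inj₁ root
⊑-chain (left p)  root = inj₂ root
⊑-chain (right p) root = inj₂ root
⊑-chain (left p)  (left q)  = [ inj₁ ∘ left , inj₂ ∘ left ]′ (⊑-chain p q)
⊑-chain (right p) (right q) = [ inj₁ ∘ right , inj₂ ∘ right ]′ (⊑-chain p q)

-- The vertex order and the label index.

module VertexOrderProperties
  {c ℓ₁ ℓ₂} {K : OrderedField c ℓ₁ ℓ₂} {n : ℕ} {G : RoadNetwork K n}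
  (T : StableTreeHierarchy G) {_≤ₜ_ : Rel (Fin n) 0ℓ} (O : IsDecTotalOrder _≡_ _≤ₜ_) where
  open RoadNetwork G using (Edge; [_]; _∷_)
  open StableTreeHierarchy T using (ℓ; separates)
  open IsDecTotalOrder O using ()
    renaming (antisym to ≤ₜ-antisym; total to ≤ₜ-total; trans to ≤ₜ-trans)
  open VertexOrder T O

  ⪯⇒⊑ : ∀ {u v} → u ⪯ v → ℓ u ⊑ ℓ v
  ⪯⇒⊑ (inj₁ (p , _)) = p
  ⪯⇒⊑ (inj₂ (p , _)) = ⊑-reflexive p

  ⪯∧≡⇒≤ₜ : ∀ {u v} → u ⪯ v → ℓ u ≡ ℓ v → u ≤ₜ v
  ⪯∧≡⇒≤ₜ (inj₁ (_ , u≢v)) u≡v = contradiction u≡v u≢v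
  ⪯∧≡⇒≤ₜ (inj₂ (_ , p))   _   = p

  -- With `⪯⇒⊑` and `⪯∧≡⇒≤ₜ` this presents `⪯` as a lexicographic order, so transitivity and
  -- antisymmetry follow componentwise.
  ⊑∧≤ₜ⇒⪯ : ∀ {u v} → ℓ u ⊑ ℓ v → (ℓ u ≡ ℓ v → u ≤ₜ v) → u ⪯ v
  ⊑∧≤ₜ⇒⪯ {u} {v} p f with ℓ u ≟ᴺ ℓ v
  ... | yes u≡v = inj₂ (u≡v , f u≡v)
  ... | no u≢v  = inj₁ (p , u≢v)

  ⪯-trans : ∀ {u v w} → u ⪯ v → v ⪯ w → u ⪯ w
  ⪯-trans {u} {v} {w} p q = ⊑∧≤ₜ⇒⪯ (⊑-trans (⪯⇒⊑ p) (⪯⇒⊑ q)) λ u≡w →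
    let u≡v = ⊑-antisym (⪯⇒⊑ p) (subst (ℓ v ⊑_) (≡.sym u≡w) (⪯⇒⊑ q))
    in ≤ₜ-trans (⪯∧≡⇒≤ₜ p u≡v) (⪯∧≡⇒≤ₜ q (≡.trans (≡.sym u≡v) u≡w))

  ⪯-antisym : ∀ {u v} → u ⪯ v → v ⪯ u → u ≡ v
  ⪯-antisym p q =
    let u≡v = ⊑-antisym (⪯⇒⊑ p) (⪯⇒⊑ q)
    in ≤ₜ-antisym (⪯∧≡⇒≤ₜ p u≡v) (⪯∧≡⇒≤ₜ q (≡.sym u≡v))

  ⊑-comparable⇒⪯-comparable : ∀ {u v} → ℓ u ⊑ ℓ v ⊎ ℓ v ⊑ ℓ u → u ⪯ v ⊎ v ⪯ u
  ⊑-comparable⇒⪯-comparable {u} {v} p with ℓ u ≟ᴺ ℓ v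
  ⊑-comparable⇒⪯-comparable {u} {v} _        | yes u≡v with ≤ₜ-total u v
  ... | inj₁ u≤v = inj₁ (inj₂ (u≡v , u≤v))
  ... | inj₂ v≤u = inj₂ (inj₂ (≡.sym u≡v , v≤u))
  ⊑-comparable⇒⪯-comparable         (inj₁ p) | no u≢v = inj₁ (inj₁ (p , u≢v))
  ⊑-comparable⇒⪯-comparable         (inj₂ p) | no u≢v = inj₂ (inj₁ (p , u≢v ∘ ≡.sym))

  ⪯-chain : ∀ {u v w} → u ⪯ w → v ⪯ w → u ⪯ v ⊎ v ⪯ u
  ⪯-chain p q = ⊑-comparable⇒⪯-comparable (⊑-chain (⪯⇒⊑ p) (⪯⇒⊑ q))

  -- Separation is applied to the two-vertex path along the edge: the endpoint it supplies lies at
  -- an ancestor of the other endpoint's node.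
  edge⇒⪯-comparable : ∀ {u v} → Edge u v → u ⪯ v ⊎ v ⪯ u
  edge⇒⪯-comparable e with separates (e ∷ [ _ ])
  ... | here (_ , p)         = ⊑-comparable⇒⪯-comparable (inj₁ p)
  ... | there (here (p , _)) = ⊑-comparable⇒⪯-comparable (inj₂ p)

  -- Transitivity carries the strict predecessors of `u` over to `v`, and `u` itself is an
  -- additional one.
  τ-mono-< : ∀ {u v} → u ⪯ v → u ≢ v → τ u ℕ.< τ v
  τ-mono-< {u} {v} u⪯v u≢v =
    count-mono-< _ _
      (λ { (w⪯u , w≢u) → ⪯-trans w⪯u u⪯v ,
           λ { refl → u≢v (⪯-antisym u⪯v w⪯u) } })
      (VecAny.map (λ { refl → (u⪯v , u≢v) , λ (_ , u≢u) → u≢u refl })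
                  (VecMembership.∈-allFin⁺ u))

  τ-mono-≤ : ∀ {u v} → u ⪯ v → τ u ℕ.≤ τ v
  τ-mono-≤ {u} {v} u⪯v with u ≟ v
  ... | yes refl = ℕₚ.≤-refl
  ... | no u≢v   = ℕₚ.<⇒≤ (τ-mono-< u⪯v u≢v)

  τ-<⇒⪯ : ∀ {u v} → u ⪯ v ⊎ v ⪯ u → τ u ℕ.< τ v → u ⪯ v
  τ-<⇒⪯ (inj₁ u⪯v) _   = u⪯v
  τ-<⇒⪯ (inj₂ v⪯u) u<v = contradiction (τ-mono-≤ v⪯u) (ℕₚ.<⇒≱ u<v)

  -- The algorithm tests only `τ`; this keeps it inside `Desc r`. If `w ⪯ v`, then `r` and `w` both
  -- precede `v`, hence are comparable, and `τ` decides the direction.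
  neighbour-∈-Desc : ∀ {r v w} → Desc r v → Edge v w → τ r ℕ.< τ w → Desc r w
  neighbour-∈-Desc r⪯v e τr<τw with edge⇒⪯-comparable e
  ... | inj₁ v⪯w = ⪯-trans r⪯v v⪯w
  ... | inj₂ w⪯v = τ-<⇒⪯ (⪯-chain r⪯v w⪯v) τr<τw

-- Inequalities in ordered fields.

module OrderedFieldProperties {c ℓ₁ ℓ₂} (K : OrderedField c ℓ₁ ℓ₂) where
  open OrderedField K renaming (refl to ≈-refl; sym to ≈-sym; trans to ≈-trans)
  open ≤-Reasoning (DecTotalOrder.poset decTotalOrder)

  <⇒≱ : ∀ {x y} → x < y → ¬ y ≤ x
  <⇒≱ = ToStrict.<⇒≱ _≈_ _≤_ antisym

  +-monoˡ-≤ : ∀ z {x y} → x ≤ y → x + z ≤ y + z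
  +-monoˡ-≤ z {x} {y} x≤y = begin
    x + z ≈⟨ +-comm x z ⟩
    z + x ≤⟨ +-monoʳ-≤ z x≤y ⟩
    z + y ≈⟨ +-comm z y ⟩
    y + z ∎

  +-mono-≤ : ∀ {w x y z} → w ≤ x → y ≤ z → w + y ≤ x + z
  +-mono-≤ w≤x y≤z = ≤-trans (+-monoˡ-≤ _ w≤x) (+-monoʳ-≤ _ y≤z)

  +-cancelˡ-≤ : ∀ z {x y} → z + x ≤ z + y → x ≤ y
  +-cancelˡ-≤ z {x} {y} p = begin
    x             ≈⟨ \\-leftDividesʳ +-group z x ⟨
    - z + (z + x) ≤⟨ +-monoʳ-≤ (- z) p ⟩
    - z + (z + y) ≈⟨ \\-leftDividesʳ +-group z y ⟩
    y             ∎

  +-monoʳ-< : ∀ z {x y} → x < y → z + x < z + y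
  +-monoʳ-< z (x≤y , x≉y) = +-monoʳ-≤ z x≤y , x≉y ∘ ∙-cancelˡ +-group z _ _

  +-monoˡ-< : ∀ z {x y} → x < y → x + z < y + z
  +-monoˡ-< z {x} {y} x<y = begin-strict
    x + z ≈⟨ +-comm x z ⟩
    z + x <⟨ +-monoʳ-< z x<y ⟩
    z + y ≈⟨ +-comm z y ⟩
    y + z ∎

  +-cancelˡ-< : ∀ z {x y} → z + x < z + y → x < y
  +-cancelˡ-< z (p , ≉) = +-cancelˡ-≤ z p , ≉ ∘ +-congˡ

  -- If both tests of Step 1 held for an update of old weight `z`, substituting one equation into
  -- the other would give this equality.
  y≉[y+z]+z : ∀ {z} y → 0# < z → ¬ y ≈ (y + z) + z
  y≉[y+z]+z {z} y 0<z y≈ = <⇒≱ y<y ≤-refl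
    where
    y<y : y < y
    y<y = begin-strict
      y           ≈⟨ +-identityʳ y ⟨
      y + 0#      <⟨ +-monoʳ-< y 0<z ⟩
      y + z       ≈⟨ +-identityʳ (y + z) ⟨
      y + z + 0#  <⟨ +-monoʳ-< (y + z) 0<z ⟩
      y + z + z   ≈⟨ y≈ ⟨
      y           ∎

-- Shortest paths and distances in one graph.

module ShortestPathProperties
  {c ℓ₁ ℓ₂} {K : OrderedField c ℓ₁ ℓ₂} {n : ℕ} (G : RoadNetwork K n) where
  open OrderedField K renaming (refl to ≈-refl; sym to ≈-sym; trans to ≈-trans)
  open OrderedFieldProperties K
  open RoadNetwork G
  open ≤-Reasoning (DecTotalOrder.poset decTotalOrder)

  -- `weight` unfolds only once the tail is seen to start with `w`, which the path derivation shows.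
  weight-∷ : ∀ {v w u q} → IsPath w u q → weight (v ∷ q) ≡ φ v w + weight q
  weight-∷ [ _ ]   = refl
  weight-∷ (_ ∷ _) = refl

  weight-nonneg : ∀ {v u p} → IsPath v u p → 0# ≤ weight p
  weight-nonneg [ _ ] = ≤-refl
  weight-nonneg (_∷_ {v} {w} {p = p} e π) = begin
    0#               ≈⟨ +-identityˡ 0# ⟨
    0# + 0#          ≤⟨ +-mono-≤ (φ-nonneg e) (weight-nonneg π) ⟩
    φ v w + weight p ≡⟨ weight-∷ π ⟨
    weight (v ∷ p)   ∎

  module _ {D : Pred (Fin n) 0ℓ} where

    head-∈ : ∀ {v u p} → IsPath v u p → All D p → D v
    head-∈ [ _ ]   (Dv ∷ _) = Dv
    head-∈ (_ ∷ _) (Dv ∷ _) = Dv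

    ∷-path : ∀ {v w u q} → D v → Edge v w → IsPathIn D w u q → IsPathIn D v u (v ∷ q)
    ∷-path Dv e (π , Dq) = e ∷ π , Dv ∷ Dq

    -- Optimal substructure: prefixing the edge to a competitor of `q` gives a competitor of
    -- `v ∷ q`, and the edge weight cancels.
    tail-shortest : ∀ {v w u q} → Edge v w → IsPath w u q →
                    IsShortestPath D v u (v ∷ q) → IsShortestPath D w u q
    tail-shortest {v} {w} {u} {q} e π ((_ , Dv ∷ Dq) , v∷q-min) = (π , Dq) , λ q′ π′ →
      +-cancelˡ-≤ (φ v w) (begin
        φ v w + weight q  ≡⟨ weight-∷ π ⟨
        weight (v ∷ q)    ≤⟨ v∷q-min (v ∷ q′) (∷-path Dv e π′) ⟩
        weight (v ∷ q′)   ≡⟨ weight-∷ (proj₁ π′) ⟩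
        φ v w + weight q′ ∎)

    shortest-weight : ∀ {v u p q} → IsShortestPath D v u p → IsShortestPath D v u q →
                      weight p ≈ weight q
    shortest-weight (π , p-min) (ρ , q-min) = antisym (p-min _ ρ) (q-min _ π)

    distance-≤ : ∀ {v u p x} → IsDistance D v u [ x ] → IsPathIn D v u p → x ≤ weight p
    distance-≤ {p = p} {x} (q , (_ , q-min) , q≈x) π = begin
      x        ≈⟨ q≈x ⟨
      weight q ≤⟨ q-min p π ⟩
      weight p ∎

    shortest⇒distance : ∀ {v u p x} → IsShortestPath D v u p → IsDistance D v u x →
                        [ weight p ] ≈⁺ x
    shortest⇒distance {x = [ x ]} sp (q , sq , q≈x) =
      SupEquality.[ ≈-trans (shortest-weight sp sq) q≈x ]
    shortest⇒distance {p = p} {⊤⁺} (π , _) (lift none) = contradiction π (none p)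

    -- This turns the algorithm's equality tests on labels into shortest paths.
    distance⇒shortest : ∀ {v u p x} → IsPathIn D v u p → IsDistance D v u x →
                        [ weight p ] ≈⁺ x → IsShortestPath D v u p
    distance⇒shortest {p = p} π (q , (_ , q-min) , q≈x) SupEquality.[ p≈x ] = π , λ q′ ρ → begin
      weight p  ≈⟨ p≈x ⟩
      _         ≈⟨ q≈x ⟨
      weight q  ≤⟨ q-min q′ ρ ⟩
      weight q′ ∎

-- Path weights before and after the increases.

module UpdateProperties
  {c ℓ₁ ℓ₂} {K : OrderedField c ℓ₁ ℓ₂} {n : ℕ} (G : RoadNetwork K n)
  (ΔG : WeightIncreases G) where
  open OrderedField K renaming (refl to ≈-refl; sym to ≈-sym; trans to ≈-trans)
  open OrderedFieldProperties K
  open ShortestPathProperties G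
  open WeightIncreases ΔG
  open RoadNetwork G
  private module G′ = RoadNetwork (G ⊕ ΔG)
  open RoadNetwork (G ⊕ ΔG) using () renaming (φ to φ′; weight to weight′)
  open ShortestPathProperties (G ⊕ ΔG) using () renaming (weight-∷ to weight′-∷)
  open Update
  open ≤-Reasoning (DecTotalOrder.poset decTotalOrder)

  updates-old : ∀ {δ u v} → IsIncrease G δ → Updates δ u v → φ-old δ ≈ φ u v
  updates-old inc (inj₁ (refl , refl)) = IsIncrease.old inc
  updates-old inc (inj₂ (refl , refl)) =
    ≈-trans (IsIncrease.old inc) (φ-sym (IsIncrease.edge inc))

  -- The first matching update in the list fixes the new weight, and every update is a strict
  -- increase.
  updatedWeight-cases : ∀ {Δ} → All (IsIncrease G) Δ → ∀ u v →
    (Any (λ δ → Updates δ u v) Δ × φ u v < updatedWeight φ Δ u v) ⊎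
    (¬ Any (λ δ → Updates δ u v) Δ × φ u v ≡ updatedWeight φ Δ u v)
  updatedWeight-cases []                    u v = inj₂ ((λ ()) , refl)
  -- Abstracting over `does` makes the `if` of `updatedWeight` compute, while `proof` keeps the
  -- evidence.
  updatedWeight-cases {δ ∷ Δ} (inc ∷ incs) u v with does (updates? δ u v) | proof (updates? δ u v)
  ... | true  | ofʸ upd = inj₁ (here upd , (begin-strict
    φ u v   ≈⟨ updates-old inc upd ⟨
    φ-old δ <⟨ IsIncrease.increase inc ⟩
    φ-new δ ∎))
  ... | false | ofⁿ ¬upd with updatedWeight-cases incs u v
  ...   | inj₁ (any , lt)  = inj₁ (there any , lt)
  ...   | inj₂ (¬any , eq) = inj₂ ((λ { (here upd) → ¬upd upd ; (there any) → ¬any any }) , eq)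

  updated⇒φ<φ′ : ∀ {δ u v} → δ ∈ updates → Updates δ u v → φ u v < φ′ u v
  updated⇒φ<φ′ {u = u} {v} δ∈ upd with updatedWeight-cases areIncreases u v
  ... | inj₁ (_ , lt)   = lt
  ... | inj₂ (¬any , _) = contradiction (lose δ∈ upd) ¬any

  φ≤φ′ : ∀ u v → φ u v ≤ φ′ u v
  φ≤φ′ u v with updatedWeight-cases areIncreases u v
  ... | inj₁ (_ , lt) = proj₁ lt
  ... | inj₂ (_ , eq) = ≤-reflexive (reflexive eq)

  path⇒path′ : ∀ {v u p} → IsPath v u p → G′.IsPath v u p
  path⇒path′ [ v ]   = G′.[ v ]
  path⇒path′ (e ∷ π) = e G′.∷ path⇒path′ π

  path′⇒path : ∀ {v u p} → G′.IsPath v u p → IsPath v u p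
  path′⇒path G′.[ v ]   = [ v ]
  path′⇒path (e G′.∷ π) = e ∷ path′⇒path π

  weight≤weight′ : ∀ {v u p} → IsPath v u p → weight p ≤ weight′ p
  weight≤weight′ [ _ ] = ≤-refl
  weight≤weight′ (_∷_ {v} {w} {p = p} e π) = begin
    weight (v ∷ p)     ≡⟨ weight-∷ π ⟩
    φ v w + weight p   ≤⟨ +-mono-≤ (φ≤φ′ v w) (weight≤weight′ π) ⟩
    φ′ v w + weight′ p ≡⟨ weight′-∷ (path⇒path′ π) ⟨
    weight′ (v ∷ p)    ∎

  ∷-<-here : ∀ {v w u p} → IsPath w u p → φ v w < φ′ v w → weight (v ∷ p) < weight′ (v ∷ p)
  ∷-<-here {v} {w} {p = p} π lt = begin-strict
    weight (v ∷ p)     ≡⟨ weight-∷ π ⟩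
    φ v w + weight p   <⟨ +-monoˡ-< (weight p) lt ⟩
    φ′ v w + weight p  ≤⟨ +-monoʳ-≤ _ (weight≤weight′ π) ⟩
    φ′ v w + weight′ p ≡⟨ weight′-∷ (path⇒path′ π) ⟨
    weight′ (v ∷ p)    ∎

  ∷-<-there : ∀ {v w u p} → IsPath w u p → weight p < weight′ p → weight (v ∷ p) < weight′ (v ∷ p)
  ∷-<-there {v} {w} {p = p} π lt = begin-strict
    weight (v ∷ p)     ≡⟨ weight-∷ π ⟩
    φ v w + weight p   <⟨ +-monoʳ-< (φ v w) lt ⟩
    φ v w + weight′ p  ≤⟨ +-monoˡ-≤ _ (φ≤φ′ v w) ⟩
    φ′ v w + weight′ p ≡⟨ weight′-∷ (path⇒path′ π) ⟨
    weight′ (v ∷ p)    ∎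

  -- An edge without update has the same weight on both sides, so it cancels and the lengthening
  -- lies in the tail.
  ∷-<⁻ : ∀ {v w u p} → IsPath w u p → weight (v ∷ p) < weight′ (v ∷ p) →
         (∃ λ δ → δ ∈ updates × Updates δ v w) ⊎ weight p < weight′ p
  ∷-<⁻ {v} {w} {p = p} π lt with updatedWeight-cases areIncreases v w
  ... | inj₁ (any , _) = inj₁ (find any)
  ... | inj₂ (_ , eq)  = inj₂ (+-cancelˡ-< (φ v w) (begin-strict
    φ v w + weight p   ≡⟨ weight-∷ π ⟨
    weight (v ∷ p)     <⟨ lt ⟩
    weight′ (v ∷ p)    ≡⟨ weight′-∷ (path⇒path′ π) ⟩
    φ′ v w + weight′ p ≡⟨ cong (_+ weight′ p) eq ⟨
    φ v w + weight′ p  ∎))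

  -- A lengthened path contains an updated edge, whose old weight is positive, and no edge is
  -- negative. Hence a lengthened closed path is beaten by the trivial one.
  lengthened⇒positive : All (λ δ → 0# < φ-old δ) updates → ∀ {v u p} → IsPath v u p →
                        weight p < weight′ p → 0# < weight p
  lengthened⇒positive pos [ _ ] lt = contradiction ≤-refl (<⇒≱ lt)
  lengthened⇒positive pos (_∷_ {v} {w} {p = p} e π) lt with ∷-<⁻ π lt
  ... | inj₁ (δ , δ∈ , upd) = begin-strict
    0#               <⟨ All.lookup pos δ∈ ⟩
    φ-old δ          ≈⟨ updates-old (All.lookup areIncreases δ∈) upd ⟩
    φ v w            ≈⟨ +-identityʳ _ ⟨
    φ v w + 0#       ≤⟨ +-monoʳ-≤ _ (weight-nonneg π) ⟩
    φ v w + weight p ≡⟨ weight-∷ π ⟨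
    weight (v ∷ p)   ∎
  ... | inj₂ lt′ = begin-strict
    0#               <⟨ lengthened⇒positive pos π lt′ ⟩
    weight p         ≈⟨ +-identityˡ _ ⟨
    0# + weight p    ≤⟨ +-monoˡ-≤ _ (φ-nonneg e) ⟩
    φ v w + weight p ≡⟨ weight-∷ π ⟨
    weight (v ∷ p)   ∎

  module _ {D : Pred (Fin n) 0ℓ} {v u : Fin n} where

    -- If nothing changed, some `q` would attain the old distance `weight p` in the updated graph,
    -- while `p` would still be shortest there at a larger weight.
    lengthened⇒different : ∀ {p} → IsShortestPath D v u p → weight p < weight′ p →
                           DifferentShortestPaths G (G ⊕ ΔG) D v u
    lengthened⇒different {p} sp lt same
      with Equivalence.to (same-length [ weight p ]) (p , sp , ≈-refl)
         | Equivalence.to (same-paths p) sp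
      where open SameShortestPaths same
    ... | q , (ρ , _) , q≈p | _ , p-min′ = <⇒≱ lt (begin
      weight′ p ≤⟨ p-min′ q ρ ⟩
      weight′ q ≈⟨ q≈p ⟩
      weight p  ∎)

    -- Without lengthening, shortest paths keep their weights, and all other weights can only grow.
    unlengthened⇒same : ∀ {x} → IsDistance D v u x →
                        (∀ {p} → IsShortestPath D v u p → ¬ weight p < weight′ p) →
                        SameShortestPaths G (G ⊕ ΔG) D v u
    unlengthened⇒same {x} dist unlengthened = record
      { same-paths  = λ p → mk⇔ to from
      ; same-length = λ where
          [ x ] → mk⇔
            (λ (p , sp , p≈x) → p , to sp , ≈-trans (≈-sym (weight≈weight′ sp)) p≈x)
            (λ (p , sp , p≈x) → p , from sp , ≈-trans (weight≈weight′ (from sp)) p≈x)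
          ⊤⁺ → mk⇔
            (λ (lift none) → lift λ p (π , Dp) → none p (path′⇒path π , Dp))
            (λ (lift none) → lift λ p (π , Dp) → none p (path⇒path′ π , Dp))
      }
      where
      weight≈weight′ : ∀ {p} → IsShortestPath D v u p → weight p ≈ weight′ p
      weight≈weight′ {p} sp@((π , _) , _) with weight p ≈? weight′ p
      ... | yes eq = eq
      ... | no neq = contradiction (weight≤weight′ π , neq) (unlengthened sp)

      to : ∀ {p} → IsShortestPath D v u p → G′.IsShortestPath D v u p
      to {p} sp@((π , Dp) , p-min) = (path⇒path′ π , Dp) , λ q (ρ , Dq) → begin
        weight′ p ≈⟨ weight≈weight′ sp ⟨
        weight p  ≤⟨ p-min q (path′⇒path ρ , Dq) ⟩
        weight q  ≤⟨ weight≤weight′ (path′⇒path ρ) ⟩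
        weight′ q ∎

      shortest-exists : ∀ {x p} → IsDistance D v u x → IsPathIn D v u p →
                        ∃ (IsShortestPath D v u)
      shortest-exists {[ _ ]} (q , sq , _) _ = q , sq
      shortest-exists {⊤⁺} (lift none) π = contradiction π (none _)

      from : ∀ {p} → G′.IsShortestPath D v u p → IsShortestPath D v u p
      -- A shortest path of `G` keeps its weight, so it bounds the new weight of `p` from above; `p`
      -- itself rules out an infinite distance.
      from {p} ((π , Dp) , p-min′) with shortest-exists dist (path′⇒path π , Dp)
      ... | q₀ , s₀@((ρ₀ , D₀) , q₀-min) = (path′⇒path π , Dp) , λ q ρ → begin
        weight p   ≤⟨ weight≤weight′ (path′⇒path π) ⟩
        weight′ p  ≤⟨ p-min′ q₀ (path⇒path′ ρ₀ , D₀) ⟩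
        weight′ q₀ ≈⟨ weight≈weight′ s₀ ⟨
        weight q₀  ≤⟨ q₀-min q ρ ⟩
        weight q   ∎

  -- The invariant of queue entries during the search; the key `d` is the distance from `v` to `u`
  -- before the increases.
  Affected : Pred (Fin n) 0ℓ → Fin n → Carrier × Fin n → Set (ℓ₁ Level.⊔ ℓ₂)
  Affected D u (d , v) =
    ∃ λ p → IsShortestPath D v u p × weight p ≈ d × weight p < weight′ p

-- Label columns, seeding and propagation of affected pairs.

module LabelSearchProperties
  {c ℓ₁ ℓ₂} {K : OrderedField c ℓ₁ ℓ₂} {n : ℕ} {G : RoadNetwork K n}
  (T : StableTreeHierarchy G) {_≤ₜ_ : Rel (Fin n) 0ℓ} (O : IsDecTotalOrder _≡_ _≤ₜ_)
  (ΔG : WeightIncreases G)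
  (a≺b : All (λ δ → VertexOrder.τ T O (Update.a δ) ℕ.< VertexOrder.τ T O (Update.b δ))
             (WeightIncreases.updates ΔG)) where
  open OrderedField K renaming (refl to ≈-refl; sym to ≈-sym; trans to ≈-trans)
  open OrderedFieldProperties K
  open ShortestPathProperties G
  open UpdateProperties G ΔG
  open WeightIncreases ΔG
  open RoadNetwork G
  open RoadNetwork (G ⊕ ΔG) using () renaming (φ to φ′; weight to weight′)
  open VertexOrder T O
  open VertexOrderProperties T O
  open LabelSearch T O ΔG
  open DecMembership (_≟_ {n}) using (_∈?_)
  open Update
  open ≤-Reasoning (DecTotalOrder.poset decTotalOrder)

  -- A round rewrites a single column, so correctness is stated per column: those of later rounds
  -- stay valid although earlier rounds have changed the labels.
  IsLabelColumn : Fin n → Labels → Set (ℓ₁ Level.⊔ ℓ₂)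
  IsLabelColumn r L = ∀ v → r ⪯ v → IsDistance (Desc r) v r (L v r)

  ≔-minimal : ∀ L v r x {w s} → ¬ (w ≡ v × s ≡ r) → (L [ v , r ]≔ x) w s ≡ L w s
  ≔-minimal L v r x {w} {s} ¬same
    rewrite dec-false (w ≟ v ×-dec s ≟ r) ¬same = refl

  module _ {r : Fin n} (L : Labels) (column : IsLabelColumn r L) where

    -- A successful test says that the updated edge followed by a shortest path from its far end
    -- attains the label of its start. The combined path is thus shortest, and its first edge
    -- lengthens it.
    seed-affected : ∀ {δ} → r ⪯ a δ → r ⪯ b δ → δ ∈ updates →
                    All (Affected (Desc r) r) (seed L r δ)
    seed-affected {δ} r⪯a r⪯b δ∈
      with L (a δ) r | L (b δ) r | column (a δ) r⪯a | column (b δ) r⪯b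
    ... | ⊤⁺    | _     | _  | _  = []
    ... | [ _ ] | ⊤⁺    | _  | _  = []
    ... | [ x ] | [ y ] | da@(p , ((π , Dp) , _) , p≈x) | db@(q , ((ρ , Dq) , _) , q≈y)
      with x + φ-old δ ≈? y | y + φ-old δ ≈? x
    ... | yes x+φ≈y | _         =
      (b δ ∷ p , distance⇒shortest (∷-path r⪯b (edge-sym e) (π , Dp)) db
                   SupEquality.[ ≈-trans b∷p≈ x+φ≈y ]
               , b∷p≈ , ∷-<-here π (updated⇒φ<φ′ δ∈ (inj₂ (refl , refl)))) ∷ []
      where
      inc = All.lookup areIncreases δ∈
      e = IsIncrease.edge inc
      b∷p≈ : weight (b δ ∷ p) ≈ x + φ-old δ
      b∷p≈ = begin-equality
        weight (b δ ∷ p)         ≡⟨ weight-∷ π ⟩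
        φ (b δ) (a δ) + weight p ≈⟨ +-cong (≈-sym (updates-old inc (inj₂ (refl , refl)))) p≈x ⟩
        φ-old δ + x              ≈⟨ +-comm _ _ ⟩
        x + φ-old δ              ∎
    ... | no _      | yes y+φ≈x =
      (a δ ∷ q , distance⇒shortest (∷-path r⪯a e (ρ , Dq)) da
                   SupEquality.[ ≈-trans a∷q≈ y+φ≈x ]
               , a∷q≈ , ∷-<-here ρ (updated⇒φ<φ′ δ∈ (inj₁ (refl , refl)))) ∷ []
      where
      inc = All.lookup areIncreases δ∈
      e = IsIncrease.edge inc
      a∷q≈ : weight (a δ ∷ q) ≈ y + φ-old δ
      a∷q≈ = begin-equality
        weight (a δ ∷ q)         ≡⟨ weight-∷ ρ ⟩
        φ (a δ) (b δ) + weight q ≈⟨ +-cong (≈-sym (updates-old inc (inj₁ (refl , refl)))) q≈y ⟩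
        φ-old δ + y              ≈⟨ +-comm _ _ ⟩
        y + φ-old δ              ∎
    ... | no _      | no _      = []

    seeds-affected : All (Affected (Desc r) r) (seeds L r)
    seeds-affected =
      Allₚ.concat⁺ (Allₚ.map⁺ (All.zipWith (λ (r⪯a , f) → f r⪯a)
        (Allₚ.all-filter (λ δ → r ⪯? a δ) updates ,
         Allₚ.filter⁺ (λ δ → r ⪯? a δ) (All.tabulate affected))))
      where
      affected : ∀ {δ} → δ ∈ updates → r ⪯ a δ → All (Affected (Desc r) r) (seed L r δ)
      affected δ∈ r⪯a = seed-affected r⪯a (neighbour-∈-Desc r⪯a e τr<τb) δ∈
        where
        e     = IsIncrease.edge (All.lookup areIncreases δ∈)
        -- Step 1 only checks `r ⪯ a δ`; the orientation of the update places `b δ` in `Desc r` as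
        -- well.
        τr<τb = ℕₚ.≤-<-trans (τ-mono-≤ r⪯a) (All.lookup a≺b δ∈)

    seed-∋-b : ∀ {δ x y} → [ x ] ≈⁺ L (a δ) r → [ y ] ≈⁺ L (b δ) r → x + φ-old δ ≈ y →
               ∃ λ d → (d , b δ) ∈ seed L r δ
    seed-∋-b {δ} x≈ y≈ eq with L (a δ) r | L (b δ) r
    seed-∋-b {δ} SupEquality.[ x≈ ] SupEquality.[ y≈ ] eq | [ x ] | [ y ]
      with x + φ-old δ ≈? y
    ... | yes _  = _ , here refl
    ... | no neq = contradiction (≈-trans (+-congʳ (≈-sym x≈)) (≈-trans eq y≈)) neq

    seed-∋-a : ∀ {δ x y} → 0# < φ-old δ → [ x ] ≈⁺ L (a δ) r → [ y ] ≈⁺ L (b δ) r →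
               y + φ-old δ ≈ x → ∃ λ d → (d , a δ) ∈ seed L r δ
    seed-∋-a {δ} 0<φ x≈ y≈ eq with L (a δ) r | L (b δ) r
    seed-∋-a {δ} 0<φ SupEquality.[ x≈ ] SupEquality.[ y≈ ] eq | [ x ] | [ y ]
      with x + φ-old δ ≈? y | y + φ-old δ ≈? x
    ... | no _   | yes _  = _ , here refl
    ... | no _   | no neq = contradiction (≈-trans (+-congʳ (≈-sym y≈)) (≈-trans eq x≈)) neq
    -- Step 1 tests `b` first; success there, with the hypothesis for `a`, would add the old weight
    -- twice to `y` without changing it.
    ... | yes x+φ≈y | _   = contradiction (begin-equality
      y                     ≈⟨ x+φ≈y ⟨
      x + φ-old δ           ≈⟨ +-congʳ (≈-trans (+-congʳ (≈-sym y≈)) (≈-trans eq x≈)) ⟨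
      y + φ-old δ + φ-old δ ∎) (y≉[y+z]+z y 0<φ)

    -- The weights of `v ∷ q` and of its tail are the labels of `v` and `w`, so the test for the end
    -- of `δ` that is `v` holds.
    seeds-complete : All (λ δ → 0# < φ-old δ) updates →
                     ∀ {δ v w q} → δ ∈ updates → Updates δ v w →
                     IsPath w r q → IsShortestPath (Desc r) v r (v ∷ q) →
                     ∃ λ d → (d , v) ∈ seeds L r
    seeds-complete pos {δ} {v} {w} {q} δ∈ upd π sp@((_ , r⪯v ∷ Dq) , _) = go upd
      where
      inc = All.lookup areIncreases δ∈

      sq : IsShortestPath (Desc r) w r q
      sq = tail-shortest (edge-of upd) π sp
        where
        edge-of : Updates δ v w → Edge v w
        edge-of (inj₁ (refl , refl)) = IsIncrease.edge inc
        edge-of (inj₂ (refl , refl)) = edge-sym (IsIncrease.edge inc)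

      r⪯w : r ⪯ w
      r⪯w = head-∈ π Dq

      weights : weight q + φ-old δ ≈ weight (v ∷ q)
      weights = begin-equality
        weight q + φ-old δ ≈⟨ +-comm _ _ ⟩
        φ-old δ + weight q ≈⟨ +-congʳ (updates-old inc upd) ⟩
        φ v w + weight q   ≡⟨ weight-∷ π ⟨
        weight (v ∷ q)     ∎

      seeded : ∀ {e} → r ⪯ a δ → e ∈ seed L r δ → e ∈ seeds L r
      seeded r⪯a e∈ = ∈-concatMap⁺ (seed L r) (lose (∈-filter⁺ (λ δ → r ⪯? a δ) δ∈ r⪯a) e∈)

      label-v : [ weight (v ∷ q) ] ≈⁺ L v r
      label-v = shortest⇒distance sp (column v r⪯v)

      label-w : [ weight q ] ≈⁺ L w r
      label-w = shortest⇒distance sq (column w r⪯w)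

      go : Updates δ v w → ∃ λ d → (d , v) ∈ seeds L r
      go (inj₁ (refl , refl)) with seed-∋-a (All.lookup pos δ∈) label-v label-w weights
      ... | d , d∈ = d , seeded r⪯v d∈
      go (inj₂ (refl , refl)) with seed-∋-b label-w label-v weights
      ... | d , d∈ = d , seeded r⪯w d∈

    -- Extending `p` to the neighbour attains the neighbour's label, and the lengthening of `p`
    -- passes to the extension.
    affectedNeighbours-affected : ∀ {d v} → Affected (Desc r) r (d , v) →
                                  All (Affected (Desc r) r) (affectedNeighbours L r d v)
    affectedNeighbours-affected {d} {v} (p , sp@((π , Dp) , _) , p≈d , lt) =
      Allₚ.map⁺ (All.map affected (Allₚ.all-filter _ (allFin n)))
      where
      affected : ∀ {w} → Edge v w × τ r ℕ.< τ w × [ d + φ v w ] ≈⁺ L w r →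
                 Affected (Desc r) r (d + φ v w , w)
      affected {w} (e , τr<τw , label-w) =
        w ∷ p , distance⇒shortest (∷-path r⪯w (edge-sym e) (π , Dp)) (column w r⪯w)
                  (SupEquality.≈⁺-trans _ ≈-trans SupEquality.[ w∷p≈ ] label-w)
              , w∷p≈ , ∷-<-there π lt
        where
        r⪯w = neighbour-∈-Desc (head-∈ π Dp) e τr<τw
        w∷p≈ : weight (w ∷ p) ≈ d + φ v w
        w∷p≈ = begin-equality
          weight (w ∷ p)   ≡⟨ weight-∷ π ⟩
          φ w v + weight p ≈⟨ +-cong (φ-sym (edge-sym e)) p≈d ⟩
          φ v w + d        ≈⟨ +-comm _ _ ⟩
          d + φ v w        ∎

    -- The search loop of Step 2.

    search-affected : ∀ {Q A A′ E} → All (Affected (Desc r) r) Q → Search L r Q A A′ E →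
                      All (Affected (Desc r) r) E
    search-affected affQ done = []
    search-affected affQ (skip (perm , _) _ s) with All-resp-↭ perm affQ
    ... | _ ∷ affQ′ = search-affected affQ′ s
    search-affected affQ (visit (perm , _) _ s) with All-resp-↭ perm affQ
    ... | aff ∷ affQ′ = Allₚ.++⁺ affN (search-affected (Allₚ.++⁺ affN affQ′) s)
      where affN = affectedNeighbours-affected aff

  -- The loop ends with an empty queue, so every entering pair is extracted, and extraction finds
  -- its vertex in the affected list or puts it there.
  search-covers : ∀ {L r Q A A′ E} → Search L r Q A A′ E →
                  A ⊆ A′ × (∀ {d v} → (d , v) ∈ Q ++ E → v ∈ A′)
  search-covers done = id , λ ()
  search-covers (skip {Q} (perm , _) v∈A s) = A⊆A′ , covers′
    where
    A⊆A′ = proj₁ (search-covers s)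
    covers′ : ∀ {d v} → (d , v) ∈ Q ++ _ → v ∈ _
    covers′ e∈ with ∈-++⁻ Q e∈
    ... | inj₂ e∈E = proj₂ (search-covers s) (∈-++⁺ʳ _ e∈E)
    ... | inj₁ e∈Q with ∈-resp-↭ perm e∈Q
    ...   | here refl  = A⊆A′ v∈A
    ...   | there e∈Q′ = proj₂ (search-covers s) (∈-++⁺ˡ e∈Q′)
  search-covers {L} {r} (visit {Q} {Q′} {d₀} {v₀} (perm , _) _ s) =
    proj₁ (search-covers s) ∘ there , covers′
    where
    N = affectedNeighbours L r d₀ v₀
    covers′ : ∀ {d v} → (d , v) ∈ Q ++ N ++ _ → v ∈ _
    covers′ e∈ with ∈-++⁻ Q e∈
    covers′ e∈ | inj₁ e∈Q with ∈-resp-↭ perm e∈Q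
    ... | here refl  = proj₁ (search-covers s) (here refl)
    ... | there e∈Q′ = proj₂ (search-covers s) (∈-++⁺ˡ (∈-++⁺ʳ N e∈Q′))
    covers′ e∈ | inj₂ e∈N++E with ∈-++⁻ N e∈N++E
    ... | inj₁ e∈N = proj₂ (search-covers s) (∈-++⁺ˡ (∈-++⁺ˡ e∈N))
    ... | inj₂ e∈E = proj₂ (search-covers s) (∈-++⁺ʳ (N ++ Q′) e∈E)

  -- A vertex joins the list in a visit, which also enqueues its neighbours; the key of that visit
  -- is recorded for propagation along a path.
  search-visited : ∀ {L r Q A A′ E} → Search L r Q A A′ E → ∀ {v} → v ∈ A′ →
                   v ∈ A ⊎ ∃ λ d → (d , v) ∈ Q ++ E × affectedNeighbours L r d v ⊆ E
  search-visited done v∈A = inj₁ v∈A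
  search-visited (skip {Q} {Q′} (perm , _) _ s) v∈A′ with search-visited s v∈A′
  ... | inj₁ v∈A = inj₁ v∈A
  ... | inj₂ (d , e∈ , N⊆E) = inj₂ (d , entered , N⊆E)
    where
    entered = [ ∈-++⁺ˡ ∘ ∈-resp-↭ (↭-sym perm) ∘ there , ∈-++⁺ʳ Q ]′ (∈-++⁻ Q′ e∈)
  search-visited {L} {r} (visit {Q} {Q′} {d₀} {v₀} (perm , _) _ s) v∈A′ with search-visited s v∈A′
  ... | inj₁ (there v∈A) = inj₁ v∈A
  ... | inj₁ (here refl) = inj₂ (_ , ∈-++⁺ˡ (∈-resp-↭ (↭-sym perm) (here refl)) , ∈-++⁺ˡ)
  ... | inj₂ (d , e∈ , N⊆E) = inj₂ (d , entered (∈-++⁻ (N ++ Q′) e∈) , ∈-++⁺ʳ N ∘ N⊆E)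
    where
    N = affectedNeighbours L r d₀ v₀
    entered : ∀ {e E} → e ∈ N ++ Q′ ⊎ e ∈ E → e ∈ Q ++ N ++ E
    entered (inj₂ e∈E) = ∈-++⁺ʳ Q (∈-++⁺ʳ N e∈E)
    entered (inj₁ e∈) with ∈-++⁻ N e∈
    ... | inj₁ e∈N  = ∈-++⁺ʳ Q (∈-++⁺ˡ e∈N)
    ... | inj₂ e∈Q′ = ∈-++⁺ˡ (∈-resp-↭ (↭-sym perm) (there e∈Q′))

  -- Induction along the path. If its first edge is updated, `v` is seeded. Otherwise the tail is
  -- lengthened and shortest, so `w` is visited, which enqueues `v`. The seeds read `L₀` and the
  -- search reads `L`, so column `r` of both must hold distances.
  search-complete : All (λ δ → 0# < φ-old δ) updates →
                    ∀ {r L₀ L A E} → IsLabelColumn r L₀ → IsLabelColumn r L →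
                    Search L r (seeds L₀ r) [] A E →
                    ∀ {v p} → IsShortestPath (Desc r) v r p → weight p < weight′ p → v ∈ A
  search-complete pos {r} {L₀} {L} {A} {E} column₀ column s = complete
    where
    complete : ∀ {v p} → IsShortestPath (Desc r) v r p → weight p < weight′ p → v ∈ A
    complete (([ _ ] , _) , _) lt = contradiction ≤-refl (<⇒≱ lt)
    complete {v} sp@((_∷_ {w = w} {p = q} e π , r⪯v ∷ Dq) , v∷q-min) lt with ∷-<⁻ π lt
    ... | inj₁ (δ , δ∈ , upd) =
      proj₂ (search-covers s) (∈-++⁺ˡ (proj₂ (seeds-complete L₀ column₀ pos δ∈ upd π sp)))
    ... | inj₂ lt′ with search-visited s (complete (tail-shortest e π sp) lt′)
    ... | inj₂ (d , d∈ , N⊆E) =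
      proj₂ (search-covers s) (∈-++⁺ʳ (seeds L₀ r)
        (N⊆E (∈-map⁺ _ (∈-filter⁺ _ (∈-allFin v)
          (edge-sym e , τ-mono-< r⪯v r≢v ,
           SupEquality.≈⁺-trans _ ≈-trans SupEquality.[ d+φ≈ ]
             (shortest⇒distance sp (column v r⪯v)))))))
      where
      affQ : All (Affected (Desc r) r) (seeds L₀ r)
      affQ = seeds-affected L₀ column₀

      aff : Affected (Desc r) r (d , w)
      aff = All.lookup (Allₚ.++⁺ affQ (search-affected L column affQ s)) d∈

      d+φ≈ : d + φ w v ≈ weight (v ∷ q)
      -- The key comes from some shortest path `p′` from `w`, which may differ from `q` but has the
      -- same weight.
      d+φ≈ = let p′ , sp′ , p′≈d , _ = aff in begin-equality
        d + φ w v         ≈⟨ +-cong p′≈d (φ-sym e) ⟨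
        weight p′ + φ v w ≈⟨ +-congʳ (shortest-weight sp′ (tail-shortest e π sp)) ⟩
        weight q + φ v w  ≈⟨ +-comm _ _ ⟩
        φ v w + weight q  ≡⟨ weight-∷ π ⟨
        weight (v ∷ q)    ∎

      r≢v : r ≢ v
      -- If `v` were `r`, the trivial path of weight zero would beat a lengthened path of positive
      -- weight.
      r≢v refl = <⇒≱ (lengthened⇒positive pos (e ∷ π) lt) (v∷q-min (r ∷ []) ([ r ] , r⪯v ∷ []))

  -- Repair enqueues only affected vertices.

  module Repair {r : Fin n} (L : Labels) (column : IsLabelColumn r L)
                {A : List (Fin n)} (A⊆Desc : ∀ {v} → v ∈ A → r ⪯ v) where

    AgreesOffA : Labels → Set c
    AgreesOffA L₁ = ∀ w → w ∉ A → L₁ w r ≡ L w r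

    -- Repair skips the neighbour r, so its keys need not be distances in G ⊕ ΔG; a
    -- lower bound by weights in G is enough, as labels off A are distances in G.
    Candidate : Carrier × Fin n → Set ℓ₂
    Candidate (d , v) = v ∈ A × ∃ λ p → IsPathIn (Desc r) v r p × weight p ≤ d

    ≔-agreesOffA : ∀ {L₁ v x} → v ∈ A → AgreesOffA L₁ → AgreesOffA (L₁ [ v , r ]≔ x)
    ≔-agreesOffA {L₁} {v} {x} v∈A agrees w w∉A =
      ≡.trans (≔-minimal L₁ v r x λ { (refl , _) → w∉A v∈A }) (agrees w w∉A)

    ∷-weight-≤ : ∀ {v w p d} → Edge v w → IsPath v r p → weight p ≤ d →
                 weight (w ∷ p) ≤ d + φ′ v w
    ∷-weight-≤ {v} {w} {p} {d} e π p≤d = begin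
      weight (w ∷ p)   ≡⟨ weight-∷ π ⟩
      φ w v + weight p ≈⟨ +-comm _ _ ⟩
      weight p + φ w v ≤⟨ +-mono-≤ p≤d (≤-trans (≤-reflexive (φ-sym (edge-sym e))) (φ≤φ′ v w)) ⟩
      d + φ′ v w       ∎

    -- The minimum runs over neighbours outside `A`; their labels are untouched, hence distances in
    -- `G`, attained by paths that extend to `v`.
    boundary-candidate : ∀ {L₁ v d} → AgreesOffA L₁ → v ∈ A →
                         [ d ] ≡ boundary L₁ r A v → Candidate (d , v)
    boundary-candidate {L₁} {v} {d} agrees v∈A eq
      with Extrema.argmin-sel totalOrder⁺ id ⊤⁺
             (map (λ w → L₁ w r +⁺ φ′ v w)
                  (filter (λ w → edge? v w ×-dec ¬? (w ∈? A) ×-dec (τ r ℕₚ.<? τ w)) (allFin n)))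
    -- The minimum is its default `⊤⁺` or an element of the list; a finite `d` leaves the latter.
    ... | inj₁ ≡⊤⁺ = contradiction (≡.trans eq ≡⊤⁺) λ ()
    ... | inj₂ ∈map with ∈-map⁻ _ ∈map
    ... | w , w∈ , ≡w with ∈-filter⁻ _ {xs = allFin n} w∈
    ... | _ , e , w∉A , τr<τw =
      v∈A , extend (L w r) (column w r⪯w)
              (≡.trans eq (≡.trans ≡w (cong (_+⁺ φ′ v w) (agrees w w∉A))))
      where
      r⪯w = neighbour-∈-Desc (A⊆Desc v∈A) e τr<τw
      extend : ∀ y → IsDistance (Desc r) w r y → [ d ] ≡ y +⁺ φ′ v w →
               ∃ λ p → IsPathIn (Desc r) v r p × weight p ≤ d
      extend [ y ] (p , ((π , Dp) , _) , p≈y) refl =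
        v ∷ p , ∷-path (A⊆Desc v∈A) e (π , Dp) , (begin
          weight (v ∷ p)   ≡⟨ weight-∷ π ⟩
          φ v w + weight p ≤⟨ +-mono-≤ (φ≤φ′ v w) (≤-reflexive p≈y) ⟩
          φ′ v w + y       ≈⟨ +-comm _ _ ⟩
          y + φ′ v w       ∎)

    entry-candidate : ∀ {v} x → (∀ {d} → [ d ] ≡ x → Candidate (d , v)) → All Candidate (entry x v)
    entry-candidate [ d ] cand = cand refl ∷ []
    entry-candidate ⊤⁺    cand = []

    reset-candidates : ∀ {vs L₁} → All (_∈ A) vs → AgreesOffA L₁ →
                       let L₂ , Q = reset r A vs L₁ in AgreesOffA L₂ × All Candidate Q
    reset-candidates [] agrees = agrees , []
    reset-candidates {v ∷ vs} {L₁} (v∈A ∷ vs⊆A) agrees =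
      let agrees₁         = ≔-agreesOffA {L₁} {x = ⊤⁺} v∈A agrees
          agrees₂ , cands = reset-candidates vs⊆A (≔-agreesOffA {L₁ [ v , r ]≔ ⊤⁺} v∈A agrees₁)
      in agrees₂ , Allₚ.++⁺
           (entry-candidate _ (boundary-candidate {L₁ [ v , r ]≔ ⊤⁺} agrees₁ v∈A)) cands

    -- A neighbour outside `A` still has its distance in `G` as label, which no path weight in `G`,
    -- hence no key, can undercut.
    improvedNeighbours-candidates : ∀ {L₁ d v} → AgreesOffA L₁ → Candidate (d , v) →
                                    All Candidate (improvedNeighbours L₁ r d v)
    improvedNeighbours-candidates {L₁} {d} {v} agrees (v∈A , p , (π , Dp) , p≤d) =
      Allₚ.map⁺ (All.map candidate (Allₚ.all-filter _ (allFin n)))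
      where
      candidate : ∀ {w} → Edge v w × τ r ℕ.< τ w × [ d + φ′ v w ] <⁺ L₁ w r →
                  Candidate (d + φ′ v w , w)
      candidate {w} (e , τr<τw , d+φ<) = w∈A (w ∈? A) , w ∷ p , w∷p , ∷-weight-≤ e π p≤d
        where
        r⪯w = neighbour-∈-Desc (A⊆Desc v∈A) e τr<τw
        w∷p = ∷-path r⪯w (edge-sym e) (π , Dp)

        not-improving : ∀ y → IsDistance (Desc r) w r y → ¬ [ d + φ′ v w ] <⁺ y
        not-improving [ y ] dist SupStrict.[ d+φ<y ] =
          <⇒≱ d+φ<y (≤-trans (distance-≤ dist w∷p) (∷-weight-≤ e π p≤d))
        not-improving ⊤⁺ (lift none) _ = none _ w∷p

        w∈A : Dec (w ∈ A) → w ∈ A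
        w∈A (yes w∈A) = w∈A
        w∈A (no w∉A)  = ⊥-elim (not-improving (L w r) (column w r⪯w)
                          (subst ([ d + φ′ v w ] <⁺_) (agrees w w∉A) d+φ<))

    relax-candidates : ∀ {L₁ Q L′ E} → AgreesOffA L₁ → All Candidate Q → Relax r L₁ Q L′ E →
                       All Candidate E
    relax-candidates agrees cands done = []
    relax-candidates agrees cands (stale (perm , _) _ s) =
      relax-candidates agrees (All.tail (All-resp-↭ perm cands)) s
    relax-candidates {L₁} agrees cands (improve (perm , _) _ s) with All-resp-↭ perm cands
    ... | cand ∷ cands′ = Allₚ.++⁺ candsN (relax-candidates agrees₁ (Allₚ.++⁺ candsN cands′) s)
      where
      agrees₁ = ≔-agreesOffA {L₁} (proj₁ cand) agrees
      candsN  = improvedNeighbours-candidates {L₁ [ _ , r ]≔ [ _ ]} agrees₁ cand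

  -- Independence and composition of rounds.

  reset-other-column : ∀ {r A s} vs {L} → s ≢ r → ∀ w → proj₁ (reset r A vs L) w s ≡ L w s
  reset-other-column []       s≢r w = refl
  reset-other-column {r} {A} (v ∷ vs) {L} s≢r w =
    ≡.trans (reset-other-column vs s≢r w)
      (≡.trans (≔-minimal (L [ v , r ]≔ ⊤⁺) v r _ (s≢r ∘ proj₂))
               (≔-minimal L v r ⊤⁺ (s≢r ∘ proj₂)))

  relax-other-column : ∀ {r L Q L′ E s} → Relax r L Q L′ E → s ≢ r → ∀ w → L′ w s ≡ L w s
  relax-other-column done s≢r w = refl
  relax-other-column (stale _ _ t) s≢r w = relax-other-column t s≢r w
  relax-other-column {r} {L} (improve {d = d} {v} _ _ t) s≢r w =
    ≡.trans (relax-other-column t s≢r w) (≔-minimal L v r [ d ] (s≢r ∘ proj₂))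

  round-other-column : ∀ {r L Q L′ E s} → Round r L Q L′ E → s ≢ r →
                       IsLabelColumn s L → IsLabelColumn s L′
  round-other-column (round {vs = vs} _ _ t) s≢r column v s⪯v =
    subst (IsDistance _ v _)
      (≡.sym (≡.trans (relax-other-column t s≢r v) (reset-other-column vs s≢r v)))
      (column v s⪯v)

  -- The key is dropped because keys arising in Repair need not be distances in `G`.
  IsAffected : Fin n → Fin n → Set (c Level.⊔ ℓ₁ Level.⊔ ℓ₂)
  IsAffected r v = ∃ λ d → Affected (Desc r) r (d , v)

  module _ {r : Fin n} (L₀ L : Labels) (column₀ : IsLabelColumn r L₀) (column : IsLabelColumn r L)
           {L′ : Labels} {E : Queue} where

    round-affected : Round r L (seeds L₀ r) L′ E → All (IsAffected r ∘ proj₂) E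
    round-affected (round {A} {vs} {E = E₁} s vs↭A t) =
      Allₚ.++⁺ (All.map (_ ,_) affQ)
        (Allₚ.++⁺ (All.map (_ ,_) affE)
          -- For the pairs of Repair only the vertex counts: it lies in `A`, so it was also queued
          -- in Step 1 or during the search.
          (Allₚ.++⁺ (All.map (affA ∘ proj₁) cands)
                    (All.map (affA ∘ proj₁) (relax-candidates agrees cands t))))
      where
      affQ = seeds-affected L₀ column₀
      affE = search-affected L column affQ s

      affA : ∀ {v} → v ∈ A → IsAffected r v
      affA v∈A with search-visited s v∈A
      ... | inj₂ (d , e∈ , _) = d , All.lookup (Allₚ.++⁺ affQ affE) e∈

      A⊆Desc : ∀ {v} → v ∈ A → r ⪯ v
      A⊆Desc v∈A with affA v∈A
      ... | _ , _ , ((π , Dp) , _) , _ = head-∈ π Dp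

      open Repair L column A⊆Desc
      reset-result = reset-candidates (All.tabulate (∈-resp-↭ vs↭A)) (λ _ _ → refl)
      agrees = proj₁ reset-result
      cands  = proj₂ reset-result

    round-complete : All (λ δ → 0# < φ-old δ) updates → Round r L (seeds L₀ r) L′ E →
                     ∀ {v p} → IsShortestPath (Desc r) v r p → weight p < weight′ p →
                     ∃ λ d → (d , v) ∈ E
    round-complete pos (round {E = E₁} s _ _) sp lt
      with search-visited s (search-complete pos {L₀ = L₀} column₀ column s sp lt)
    ... | inj₂ (d , e∈ , _) with ∈-++⁻ (seeds L₀ r) e∈
    ...   | inj₁ e∈Q = d , ∈-++⁺ˡ e∈Q
    ...   | inj₂ e∈E = d , ∈-++⁺ʳ (seeds L₀ r) (∈-++⁺ˡ e∈E)

  module _ {L₀ : Labels} (labelling : IsStableTreeLabelling L₀) where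

    private
      column₀ : ∀ r → IsLabelColumn r L₀
      column₀ r v = labelling v r

    -- `Unique rs` ensures that column `r` is untouched until its own round.
    rounds-affected : ∀ {rs L L′ S} → Unique rs → (∀ {r} → r ∈ rs → IsLabelColumn r L) →
                      Rounds L₀ rs L L′ S → All (λ (v , r) → IsAffected r v) S
    rounds-affected [] columns [] = []
    rounds-affected (r∉rs ∷ unique) columns (ρ ∷ ρs) =
      Allₚ.++⁺ (Allₚ.map⁺ (round-affected L₀ _ (column₀ _) (columns (here refl)) ρ))
        (rounds-affected unique
          (λ s∈ → round-other-column ρ (λ { refl → All.lookup r∉rs s∈ refl }) (columns (there s∈)))
          ρs)

    rounds-complete : All (λ δ → 0# < φ-old δ) updates →
                      ∀ {rs L L′ S} → Unique rs → (∀ {r} → r ∈ rs → IsLabelColumn r L) →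
                      Rounds L₀ rs L L′ S → ∀ {v r p} → r ∈ rs →
                      IsShortestPath (Desc r) v r p → weight p < weight′ p → (v , r) ∈ S
    rounds-complete pos (_ ∷ _) columns (ρ ∷ _) (here refl) sp lt =
      ∈-++⁺ˡ (∈-map⁺ _ (proj₂ (round-complete L₀ _ (column₀ _) (columns (here refl)) pos ρ sp lt)))
    rounds-complete pos (r∉rs ∷ unique) columns (ρ ∷ ρs) (there r∈) sp lt =
      ∈-++⁺ʳ _ (rounds-complete pos unique
        (λ s∈ → round-other-column ρ (λ { refl → All.lookup r∉rs s∈ refl }) (columns (there s∈)))
        ρs r∈ sp lt)

lemma6p2 :
  ∀ {c ℓ₁ ℓ₂} {K : OrderedField c ℓ₁ ℓ₂} {n : ℕ} (G : RoadNetwork K n)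
    (T : StableTreeHierarchy G)
    {_≤ₜ_ : Rel (Fin n) 0ℓ} (O : IsDecTotalOrder _≡_ _≤ₜ_)
    (ΔG : WeightIncreases G) →
  let open OrderedField K using (_<_)
      open OrderedField K using (0#)
      open VertexOrder T O
      open LabelSearch T O ΔG
      open WeightIncreases ΔG
      open Update
  in
  All (λ δ → τ (a δ) ℕ.< τ (b δ)) updates →
  -- Needed: with an update of old weight zero the equivalence can fail, e.g. for an
  -- edge (r , c) raised from 0 to 1, where (r , c , r) ceases to be a shortest path.
  All (λ δ → 0# < φ-old δ) updates →
  (L : Labels) → IsStableTreeLabelling L →
  (L′ : Labels) (L⁺Δ : List (Fin n × Fin n)) → Run L L′ L⁺Δ →
  ∀ v r → r ⪯ v →
  ((v , r) ∈ L⁺Δ) ⇔ DifferentShortestPaths G (G ⊕ ΔG) (Desc r) v r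
lemma6p2 {n = n} G T O ΔG a≺b pos L labelling L′ L⁺Δ (LabelSearch.run {rs} rs↭ ρs) v r r⪯v =
  mk⇔ to from
  where
  open LabelSearchProperties T O ΔG a≺b
  open UpdateProperties G ΔG
  open DecMembership (Productₚ.≡-dec (_≟_ {n}) (_≟_ {n})) using (_∈?_)

  unique : Unique rs
  unique = PermSetoid.Unique-resp-↭ (setoid (Fin n)) (↭⇒↭ₛ (↭-sym rs↭)) (Uniqueₚ.allFin⁺ n)

  to : (v , r) ∈ L⁺Δ → DifferentShortestPaths G (G ⊕ ΔG) _ v r
  to vr∈ with All.lookup (rounds-affected labelling unique (λ _ v → labelling v _) ρs) vr∈
  ... | _ , _ , sp , _ , lt = lengthened⇒different sp lt

  from : DifferentShortestPaths G (G ⊕ ΔG) _ v r → (v , r) ∈ L⁺Δ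
  -- Deciding membership allows an indirect argument: if the pair is missing, no shortest path is
  -- lengthened, so nothing has changed.
  from different with (v , r) ∈? L⁺Δ
  ... | yes vr∈ = vr∈
  ... | no vr∉  = contradiction
    (unlengthened⇒same (labelling v r r⪯v) λ sp lt → vr∉
      (rounds-complete labelling pos unique (λ _ v → labelling v _) ρs
        (∈-resp-↭ (↭-sym rs↭) (∈-allFin r)) sp lt))
    different
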